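{- Let $n$ be an odd positive integer and let $m=2^l m_1$, where $m_1$ is an odd positive integer and $l\ge 0$ is an integer. Then $L_m(n)=l$.
   Context: For positive integers $m,n$, the Ducci function is the map $D:\mathbb{Z}_m^n\to\mathbb{Z}_m^n$ (where $\mathbb{Z}_m=\mathbb{Z}/m\mathbb{Z}$) given by $D(x_1,x_2,\dots,x_n)=(x_1+x_2,\,x_2+x_3,\,\dots,\,x_n+x_1)$, all entries taken modulo $m$ (indices are cyclic modulo $n$; for $n=1$, $D(x_1)=(2x_1)$). $D^{\alpha}$ denotes the $\alpha$-fold iterate, $D^0$ being the identity. For $\mathbf{u}\in\mathbb{Z}_m^n$, the length $\mathrm{Len}(\mathbf{u})$ is the smallest integer $\alpha\ge 0$ for which there exists an integer $\beta\ge 1$ with $D^{\alpha+\beta}(\mathbf{u})=D^{\alpha}(\mathbf{u})$. Define $L_m(n)=\mathrm{Len}(0,0,\dots,0,1)$, where $(0,0,\dots,0,1)\in\mathbb{Z}_m^n$. -}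

module Defs where

open import Data.Fin.Base using (Fin; toℕ)
open import Data.Nat.Base using (ℕ; suc; _+_; _≤_; NonZero)
open import Data.Nat.Divisibility using (_∤_)
open import Data.Nat.DivMod using (_mod_)
open import Data.Nat.GeneralisedArithmetic using (iterate)
open import Data.Product.Base using (_×_; ∃-syntax)
open import Data.Vec.Base using (Vec; lookup; replicate; tabulate; _∷ʳ_)
open import Relation.Binary.PropositionalEquality.Core using (_≡_)

Odd : ℕ → Set
Odd n = 2 ∤ n

-- ℤ/mℤ, each class being represented by its remainder in {0,…,m-1}.
ℤ/ : ℕ → Set
ℤ/ m = Fin m

infixl 6 _⊕_

_⊕_ : ∀ {m} .{{_ : NonZero m}} → ℤ/ m → ℤ/ m → ℤ/ m
_⊕_ {m} a b = (toℕ a + toℕ b) mod m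

next : ∀ {n} .{{_ : NonZero n}} → Fin n → Fin n
next {n} i = suc (toℕ i) mod n

D : ∀ {m n} .{{_ : NonZero m}} .{{_ : NonZero n}} → Vec (ℤ/ m) n → Vec (ℤ/ m) n
D u = tabulate λ i → lookup u i ⊕ lookup u (next i)

IsLeast : (ℕ → Set) → ℕ → Set
IsLeast P a = P a × (∀ b → P b → a ≤ b)

-- Read "Len(u) = a".  Len is given by its graph: a function would need a proof
-- that every orbit is eventually periodic.
IsLen : ∀ {m n} .{{_ : NonZero m}} .{{_ : NonZero n}} → Vec (ℤ/ m) n → ℕ → Set
IsLen u = IsLeast λ α → ∃[ β ] 1 ≤ β × iterate D u (α + β) ≡ iterate D u α

-- (0,…,0,1); the entry 1 is taken modulo m, so it is 0 when m = 1.
e : ∀ m n .{{_ : NonZero m}} .{{_ : NonZero n}} → Vec (ℤ/ m) n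
e m (suc k) = replicate k (0 mod m) ∷ʳ (1 mod m)

-- Read "L_m(n) = a".
IsL : ∀ m n .{{_ : NonZero m}} .{{_ : NonZero n}} → ℕ → Set
IsL m n = IsLen (e m n)

{-# OPTIONS --safe #-}
module Submission where

-- The entry sum doubles under D, so D^α(0,…,0,1) has sum 2^α modulo m.  If
-- D^(α+β) and D^α agree with β ≥ 1, then 2^(α+1) ∤ 2^α forces l ≤ α.
--
-- Conversely, D is injective on vectors whose sums agree modulo 2^l: if D u = D v,
-- then w = u − v satisfies w_k + w_(k+1) = 0, so, n being odd, 2 w_0 = 0 and the sum
-- of w is w_0; hence both m₁ and 2^l divide w_0.  All D^(l+i)(0,…,0,1) have sum 0
-- modulo 2^l, so a repetition among them, found by pigeonhole, can be cancelled down
-- to i = 0.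

open import Defs
open import Data.Fin.Base using (Fin; zero; suc; toℕ; funToFin; finToFun)
open import Data.Fin.Properties
  using (toℕ-fromℕ<; toℕ-injective; toℕ<n; pigeonhole; finToFun-funToFin)
open import Data.Integer.Base as ℤ using (ℤ; +_; 0ℤ; 1ℤ)
import Data.Integer.Properties as ℤ
open import Data.Integer.Divisibility.Signed
  using (_∣_; divides; ∣ᵤ⇒∣; ∣⇒∣ᵤ; ∣-trans; ∣m∣n⇒∣m+n; ∣m∣n⇒∣m-n; ∣n⇒∣m*n; *-monoˡ-∣)
open import Data.Integer.Tactic.RingSolver using (solve)
open import Data.List.Base using ([]; _∷_)
open import Data.Nat.Base
  using (ℕ; zero; suc; _+_; _*_; _^_; _∸_; _≤_; _<_; z≤n; s≤s;
         _/_; _%_; _⊔_; NonZero; >-nonZero⁻¹)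
open import Data.Nat.Divisibility as ℕ∣ using (m%n≡0⇒n∣m; >⇒∤)
open import Data.Nat.DivMod
  using (_mod_; m%n<n; m%n≤m; m%n%n≡m%n; n%n≡0; m<n⇒m%n≡m; m≡m%n+[m/n]*n; %-distribˡ-+)
open import Data.Nat.GeneralisedArithmetic using (iterate)
import Data.Nat.Properties as ℕ
open import Data.Product.Base using (_×_; _,_; ∃-syntax)
open import Data.Vec.Base using (Vec; _∷ʳ_; lookup; replicate; tabulate)
open import Data.Vec.Properties using (lookup∘tabulate; tabulate∘lookup; tabulate-cong)
open import Function.Base using (_∘_)
open import Relation.Binary.PropositionalEquality
  using (_≡_; refl; sym; trans; cong; cong₂; subst; module ≡-Reasoning)
open import Relation.Nullary.Negation using (contradiction)

-- Parity, iteration, and congruences as integer divisibility.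

odd⇒suc-double : ∀ n → Odd n → ∃[ q ] n ≡ suc (q * 2)
odd⇒suc-double n 2∤n with n % 2 in eq | m%n<n n 2 | m≡m%n+[m/n]*n n 2
... | 0 | _ | _ = contradiction (m%n≡0⇒n∣m n 2 eq) 2∤n
... | 1 | _ | n≡ = n / 2 , n≡
... | suc (suc _) | s≤s (s≤s ()) | _

iterate-suc : ∀ {A : Set} (f : A → A) x n → iterate f x (suc n) ≡ f (iterate f x n)
iterate-suc f x zero    = refl
iterate-suc f x (suc n) = iterate-suc f (f x) n

-- Both numbers lie in [0, m), so their difference has absolute value below `m`, and 0 is the only
-- multiple of `m` that small.
∣-difference⇒≡ : ∀ {m a b} → a < m → b < m → + m ∣ (+ a ℤ.- + b) → a ≡ b
∣-difference⇒≡ {m} {a} {b} a<m b<m m∣a-b =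
  ℤ.+-injective (ℤ.i-j≡0⇒i≡j (+ a) (+ b) (ℤ.∣i∣≡0⇒i≡0 (small (∣⇒∣ᵤ m∣a-b) bound)))
  where
  small : ∀ {k} → m ℕ∣.∣ k → k < m → k ≡ 0
  small {zero}  _   _   = refl
  small {suc k} m∣k k<m = contradiction m∣k (>⇒∤ k<m)

  bound : ℤ.∣ + a ℤ.- + b ∣ < m
  bound = ℕ.≤-<-trans
    (subst (λ z → ℤ.∣ z ∣ ≤ a ⊔ b) (sym (ℤ.m-n≡m⊖n a b)) (ℤ.∣m⊝n∣≤m⊔n a b))
    (ℕ.⊔-lub a<m b<m)

m∣a%m-a : ∀ m a .{{_ : NonZero m}} → + m ∣ (+ (a % m) ℤ.- + a)
m∣a%m-a m a = divides (ℤ.- + (a / m)) (begin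
  + (a % m) ℤ.- + a
    ≡⟨ cong (λ z → + (a % m) ℤ.- z) a≡ ⟩
  + (a % m) ℤ.- (+ (a % m) ℤ.+ + (a / m) ℤ.* + m)
    ≡⟨ cancel (+ (a % m)) (+ (a / m)) (+ m) ⟩
  ℤ.- + (a / m) ℤ.* + m ∎)
  where
  open ≡-Reasoning

  a≡ : + a ≡ + (a % m) ℤ.+ + (a / m) ℤ.* + m
  a≡ = trans (cong +_ (m≡m%n+[m/n]*n a m)) (cong (λ z → + (a % m) ℤ.+ z) (ℤ.pos-* (a / m) m))

  cancel : ∀ r q k → r ℤ.- (r ℤ.+ q ℤ.* k) ≡ ℤ.- q ℤ.* k
  cancel r q k = solve (r ∷ q ∷ k ∷ [])

-- Sums of integer sequences.

sum : (ℕ → ℤ) → ℕ → ℤ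
sum w zero    = 0ℤ
sum w (suc n) = sum w n ℤ.+ w n

sum-sub : ∀ f g n → sum (λ k → f k ℤ.- g k) n ≡ sum f n ℤ.- sum g n
sum-sub f g zero    = refl
sum-sub f g (suc n) =
  trans (cong (ℤ._+ (f n ℤ.- g n)) (sum-sub f g n)) (regroup (sum f n) (sum g n) (f n) (g n))
  where
  regroup : ∀ a b c d → a ℤ.- b ℤ.+ (c ℤ.- d) ≡ a ℤ.+ c ℤ.- (b ℤ.+ d)
  regroup a b c d = solve (a ∷ b ∷ c ∷ d ∷ [])

sum-∣ : ∀ {d} w n → (∀ k → d ∣ w k) → d ∣ sum w n
sum-∣ w zero    d∣w = divides 0ℤ refl
sum-∣ w (suc n) d∣w = ∣m∣n⇒∣m+n (sum-∣ w n d∣w) (d∣w n)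

-- Shifting the summation window by one loses `w 0` and gains `w n`. For an `n`-periodic `w` this
-- correction vanishes, which is why entry sums double.
sum-neighbours : ∀ w n →
  sum (λ k → w k ℤ.+ w (suc k)) n ≡ sum w n ℤ.+ sum w n ℤ.+ (w n ℤ.- w 0)
sum-neighbours w zero    = sym (trans (ℤ.+-identityˡ _) (ℤ.+-inverseʳ (w 0)))
sum-neighbours w (suc n) =
  trans (cong (ℤ._+ (w n ℤ.+ w (suc n))) (sum-neighbours w n))
        (regroup (sum w n) (w n) (w (suc n)) (w 0))
  where
  regroup : ∀ s a b c →
    s ℤ.+ s ℤ.+ (a ℤ.- c) ℤ.+ (a ℤ.+ b) ≡ s ℤ.+ a ℤ.+ (s ℤ.+ a) ℤ.+ (b ℤ.- c)
  regroup s a b c = solve (s ∷ a ∷ b ∷ c ∷ [])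

-- Sequences that alternate in sign modulo `d`.

module Alternating {d : ℤ} (w : ℕ → ℤ) (d∣ : ∀ k → d ∣ (w k ℤ.+ w (suc k))) where

  -- Two sign changes cancel: adding the relation at `q * 2` and subtracting the next one replaces
  -- w_(2q) by w_(2q+2).
  even-term : ∀ q → d ∣ (w 0 ℤ.- w (q * 2))
  even-term zero    = divides 0ℤ (ℤ.+-inverseʳ (w 0))
  even-term (suc q) = subst (d ∣_)
    (regroup (w 0) (w (q * 2)) (w (suc (q * 2))) (w (suc (suc (q * 2)))))
    (∣m∣n⇒∣m-n (∣m∣n⇒∣m+n (even-term q) (d∣ (q * 2))) (d∣ (suc (q * 2))))
    where
    regroup : ∀ a b c e → a ℤ.- b ℤ.+ (b ℤ.+ c) ℤ.- (c ℤ.+ e) ≡ a ℤ.- e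
    regroup a b c e = solve (a ∷ b ∷ c ∷ e ∷ [])

  -- After `w 0` the terms group into pairs w_1 + w_2, w_3 + w_4, ..., each divisible by `d`.
  odd-sum : ∀ q → d ∣ (sum w (suc (q * 2)) ℤ.- w 0)
  odd-sum zero    =
    divides 0ℤ (trans (cong (ℤ._- w 0) (ℤ.+-identityˡ (w 0))) (ℤ.+-inverseʳ (w 0)))
  odd-sum (suc q) = subst (d ∣_)
    (regroup (sum w (suc (q * 2))) (w 0) (w (suc (q * 2))) (w (suc (suc (q * 2)))))
    (∣m∣n⇒∣m+n (odd-sum q) (d∣ (suc (q * 2))))
    where
    regroup : ∀ s a b c → s ℤ.- a ℤ.+ (b ℤ.+ c) ≡ s ℤ.+ b ℤ.+ c ℤ.- a
    regroup s a b c = solve (s ∷ a ∷ b ∷ c ∷ [])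

  -- An odd number of steps reverses the sign, so w_(2q+1) is congruent to -w_0, while closing the
  -- cycle identifies it with w_0.
  double-first : ∀ q → w (suc (q * 2)) ≡ w 0 → d ∣ (w 0 ℤ.+ w 0)
  double-first q closed = subst (d ∣_)
    (trans (regroup (w 0) (w (q * 2)) (w (suc (q * 2)))) (cong (λ z → w 0 ℤ.+ z) closed))
    (∣m∣n⇒∣m+n (even-term q) (d∣ (q * 2)))
    where
    regroup : ∀ a b c → a ℤ.- b ℤ.+ (b ℤ.+ c) ≡ a ℤ.+ c
    regroup a b c = solve (a ∷ b ∷ c ∷ [])

  all-terms : d ∣ w 0 → ∀ k → d ∣ w k
  all-terms d∣w₀ zero    = d∣w₀
  all-terms d∣w₀ (suc k) = subst (d ∣_) (regroup (w k) (w (suc k)))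
    (∣m∣n⇒∣m-n (d∣ k) (all-terms d∣w₀ k))
    where
    regroup : ∀ a b → a ℤ.+ b ℤ.- a ≡ b
    regroup a b = solve (a ∷ b ∷ [])

-- x = (2r+1) x − r (2x).
odd-part-cancel : ∀ {m p} r x → m ≡ p * suc (r * 2) →
  + p ∣ x → + m ∣ (x ℤ.+ x) → + m ∣ x
odd-part-cancel {m} {p} r x refl p∣x m∣2x = subst (+ m ∣_)
  (trans (cong (λ z → x ℤ.* z ℤ.- + r ℤ.* (x ℤ.+ x)) odd) (regroup x (+ r)))
  (∣m∣n⇒∣m-n
    (subst (_∣ x ℤ.* + suc (r * 2)) (sym (ℤ.pos-* p (suc (r * 2))))
      (*-monoˡ-∣ (+ suc (r * 2)) p∣x))
    (∣n⇒∣m*n (+ r) m∣2x))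
  where
  odd : + suc (r * 2) ≡ 1ℤ ℤ.+ + r ℤ.* + 2
  odd = cong (λ z → 1ℤ ℤ.+ z) (ℤ.pos-* r 2)

  regroup : ∀ x r → x ℤ.* (1ℤ ℤ.+ r ℤ.* + 2) ℤ.- r ℤ.* (x ℤ.+ x) ≡ x
  regroup x r = solve (x ∷ r ∷ [])

-- Reduced indices and entries; repetition in a finite set.

mod-cong : ∀ {m a b} .{{_ : NonZero m}} → a % m ≡ b % m → a mod m ≡ b mod m
mod-cong {m} {a} {b} eq = toℕ-injective
  (trans (toℕ-fromℕ< (m%n<n a m)) (trans eq (sym (toℕ-fromℕ< (m%n<n b m)))))

toℕ-mod : ∀ a m .{{_ : NonZero m}} → toℕ (a mod m) ≡ a % m
toℕ-mod a m = toℕ-fromℕ< (m%n<n a m)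

-- Lets `D` be described on natural-number indices, where the cyclic successor is the ordinary one.
next-mod : ∀ k n .{{_ : NonZero n}} → next (k mod n) ≡ suc k mod n
next-mod k n = mod-cong (begin
  suc (toℕ (k mod n)) % n     ≡⟨ cong (λ a → suc a % n) (toℕ-mod k n) ⟩
  suc (k % n) % n             ≡⟨ %-distribˡ-+ 1 (k % n) n ⟩
  (1 % n + k % n % n) % n     ≡⟨ cong (λ a → (1 % n + a) % n) (m%n%n≡m%n k n) ⟩
  (1 % n + k % n) % n         ≡⟨ %-distribˡ-+ 1 k n ⟨
  suc k % n                   ∎)
  where open ≡-Reasoning

lookup-∷ʳ-init : ∀ {A : Set} k (x y : A) (i : Fin (suc k)) →
  toℕ i < k → lookup (replicate k x ∷ʳ y) i ≡ x
lookup-∷ʳ-init (suc k) x y zero    _         = refl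
lookup-∷ʳ-init (suc k) x y (suc i) (s≤s i<k) = lookup-∷ʳ-init k x y i i<k

lookup-∷ʳ-last : ∀ {A : Set} k (x y : A) (i : Fin (suc k)) →
  toℕ i ≡ k → lookup (replicate k x ∷ʳ y) i ≡ y
lookup-∷ʳ-last zero    x y zero    _  = refl
lookup-∷ʳ-last (suc k) x y (suc i) eq = lookup-∷ʳ-last k x y i (ℕ.suc-injective eq)

orbit-repeats : ∀ {m n} (f : ℕ → Vec (Fin m) n) →
  ∃[ i ] ∃[ j ] i < j × f i ≡ f j
orbit-repeats {m} {n} f
  -- There are m^n codes for vectors, so two of the first m^n + 1 terms share one; `decoded`
  -- recovers a vector from its code.
  with i , j , i<j , eq ← pigeonhole (ℕ.n<1+n (m ^ n)) (λ i → funToFin (lookup (f (toℕ i))))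
  = toℕ i , toℕ j , i<j , (begin
    f (toℕ i)            ≡⟨ decoded≡ (f (toℕ i)) ⟨
    decoded (f (toℕ i))  ≡⟨ cong (tabulate ∘ finToFun) eq ⟩
    decoded (f (toℕ j))  ≡⟨ decoded≡ (f (toℕ j)) ⟩
    f (toℕ j)            ∎)
  where
  open ≡-Reasoning

  decoded : Vec (Fin m) n → Vec (Fin m) n
  decoded u = tabulate (finToFun (funToFin (lookup u)))

  decoded≡ : ∀ u → decoded u ≡ u
  decoded≡ u = trans (tabulate-cong (finToFun-funToFin (lookup u))) (tabulate∘lookup u)

-- The Ducci map on periodic integer sequences.

module _ {m n : ℕ} .{{_ : NonZero m}} .{{_ : NonZero n}} where

  -- The n-periodic extension of u, so that the cyclic successor of k is k + 1.
  ⟦_⟧ : Vec (ℤ/ m) n → ℕ → ℤ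
  ⟦ u ⟧ k = + toℕ (lookup u (k mod n))

  total : Vec (ℤ/ m) n → ℤ
  total u = sum ⟦ u ⟧ n

  ⟦⟧-periodic : ∀ u → ⟦ u ⟧ n ≡ ⟦ u ⟧ 0
  ⟦⟧-periodic u = cong (+_ ∘ toℕ ∘ lookup u)
    (mod-cong (trans (n%n≡0 n) (sym (m<n⇒m%n≡m (>-nonZero⁻¹ n)))))

  -- Entries are canonical remainders, so congruence modulo `m` already makes them equal, and the
  -- indices below `n` reach all of them.
  ⟦⟧-injective : ∀ u v → (∀ k → + m ∣ (⟦ u ⟧ k ℤ.- ⟦ v ⟧ k)) → u ≡ v
  ⟦⟧-injective u v m∣ = begin
    u                    ≡⟨ tabulate∘lookup u ⟨
    tabulate (lookup u)  ≡⟨ tabulate-cong entries ⟩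
    tabulate (lookup v)  ≡⟨ tabulate∘lookup v ⟩
    v                    ∎
    where
    open ≡-Reasoning

    toℕ-mod-id : ∀ (i : Fin n) → toℕ i mod n ≡ i
    toℕ-mod-id i = toℕ-injective (trans (toℕ-mod (toℕ i) n) (m<n⇒m%n≡m (toℕ<n i)))

    entries : ∀ i → lookup u i ≡ lookup v i
    entries i = subst (λ j → lookup u j ≡ lookup v j) (toℕ-mod-id i)
      (toℕ-injective (∣-difference⇒≡ (toℕ<n _) (toℕ<n _) (m∣ (toℕ i))))

  -- Only a congruence: `D` reduces its entries modulo `m`, the integer sum of neighbours is not
  -- reduced.
  ⟦D⟧ : ∀ u k → + m ∣ (⟦ D u ⟧ k ℤ.- (⟦ u ⟧ k ℤ.+ ⟦ u ⟧ (suc k)))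
  ⟦D⟧ u k = subst (λ a → + m ∣ (+ a ℤ.- + s)) (sym entry) (m∣a%m-a m s)
    where
    open ≡-Reasoning

    s : ℕ
    s = toℕ (lookup u (k mod n)) + toℕ (lookup u (suc k mod n))

    entry : toℕ (lookup (D u) (k mod n)) ≡ s % m
    entry = begin
      toℕ (lookup (D u) (k mod n))
        ≡⟨ cong toℕ (lookup∘tabulate _ (k mod n)) ⟩
      toℕ (lookup u (k mod n) ⊕ lookup u (next (k mod n)))
        ≡⟨ cong (λ i → toℕ (lookup u (k mod n) ⊕ lookup u i)) (next-mod k n) ⟩
      toℕ (s mod m)
        ≡⟨ toℕ-mod s m ⟩
      s % m ∎

  total-D : ∀ u → + m ∣ (total (D u) ℤ.- (total u ℤ.+ total u))
  total-D u = subst (+ m ∣_) eq (sum-∣ _ n (⟦D⟧ u))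
    where
    open ≡-Reasoning

    eq : sum (λ k → ⟦ D u ⟧ k ℤ.- (⟦ u ⟧ k ℤ.+ ⟦ u ⟧ (suc k))) n
       ≡ total (D u) ℤ.- (total u ℤ.+ total u)
    eq = begin
      sum (λ k → ⟦ D u ⟧ k ℤ.- (⟦ u ⟧ k ℤ.+ ⟦ u ⟧ (suc k))) n
        ≡⟨ sum-sub ⟦ D u ⟧ _ n ⟩
      total (D u) ℤ.- sum (λ k → ⟦ u ⟧ k ℤ.+ ⟦ u ⟧ (suc k)) n
        ≡⟨ cong (λ z → total (D u) ℤ.- z) (sum-neighbours ⟦ u ⟧ n) ⟩
      total (D u) ℤ.- (total u ℤ.+ total u ℤ.+ (⟦ u ⟧ n ℤ.- ⟦ u ⟧ 0))
        ≡⟨ cong (λ z → total (D u) ℤ.- (total u ℤ.+ total u ℤ.+ z))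
             (ℤ.i≡j⇒i-j≡0 (⟦⟧-periodic u)) ⟩
      total (D u) ℤ.- (total u ℤ.+ total u ℤ.+ 0ℤ)
        ≡⟨ cong (λ z → total (D u) ℤ.- z) (ℤ.+-identityʳ _) ⟩
      total (D u) ℤ.- (total u ℤ.+ total u) ∎

  total-iterate : ∀ u → + m ∣ (total u ℤ.- 1ℤ) →
    ∀ k → + m ∣ (total (iterate D u k) ℤ.- + (2 ^ k))
  total-iterate u m∣ zero    = m∣
  total-iterate u m∣ (suc k) =
    subst (λ v → + m ∣ (total v ℤ.- + (2 ^ suc k))) (sym (iterate-suc D u k))
    (subst (+ m ∣_)
      (trans (regroup (total (D v)) (total v) (+ (2 ^ k)))
             (cong (λ z → total (D v) ℤ.- z) (sym (ℤ.pos-* 2 (2 ^ k)))))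
      -- The error at step k + 1 is the error of one doubling plus twice the error at step k.
      (∣m∣n⇒∣m+n (total-D v) (∣n⇒∣m*n (+ 2) (total-iterate u m∣ k))))
    where
    v : Vec (ℤ/ m) n
    v = iterate D u k

    regroup : ∀ a b c → a ℤ.- (b ℤ.+ b) ℤ.+ + 2 ℤ.* (b ℤ.- c) ≡ a ℤ.- + 2 ℤ.* c
    regroup a b c = solve (a ∷ b ∷ c ∷ [])

  -- Used with `p` equal to `2 ^ l`. Going round the odd cycle yields only 2 w_0 ≡ 0 modulo `m`; the
  -- sums supply the divisibility of w_0 by `p` that makes up for the factor 2, and w_0 then
  -- controls every term.
  D-cancel : ∀ {p q r} → n ≡ suc (q * 2) → m ≡ p * suc (r * 2) → ∀ u v →
    + p ∣ (total u ℤ.- total v) → D u ≡ D v → u ≡ v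
  D-cancel {p} {q} {r} n≡ m≡ u v p∣ Du≡Dv = ⟦⟧-injective u v (all-terms m∣w₀)
    where
    w : ℕ → ℤ
    w k = ⟦ u ⟧ k ℤ.- ⟦ v ⟧ k

    regroup : ∀ a b c d e → e ℤ.- (c ℤ.+ d) ℤ.- (e ℤ.- (a ℤ.+ b)) ≡ a ℤ.- c ℤ.+ (b ℤ.- d)
    regroup a b c d e = solve (a ∷ b ∷ c ∷ d ∷ e ∷ [])

    -- Both sums of neighbours are congruent to the same entry of `D v`, which drops out on
    -- subtraction.
    m∣w+w : ∀ k → + m ∣ (w k ℤ.+ w (suc k))
    m∣w+w k = subst (+ m ∣_)
      (regroup (⟦ u ⟧ k) (⟦ u ⟧ (suc k)) (⟦ v ⟧ k) (⟦ v ⟧ (suc k)) (⟦ D v ⟧ k))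
      (∣m∣n⇒∣m-n (⟦D⟧ v k)
        (subst (λ x → + m ∣ (⟦ x ⟧ k ℤ.- (⟦ u ⟧ k ℤ.+ ⟦ u ⟧ (suc k)))) Du≡Dv (⟦D⟧ u k)))

    open Alternating w m∣w+w

    closed : w (suc (q * 2)) ≡ w 0
    closed = subst (λ k → w k ≡ w 0) n≡ (cong₂ ℤ._-_ (⟦⟧-periodic u) (⟦⟧-periodic v))

    p∣m : + p ∣ + m
    p∣m = ∣ᵤ⇒∣ (ℕ∣.divides (suc (r * 2)) (trans m≡ (ℕ.*-comm p _)))

    -- The sum of w is 0 modulo `p` by hypothesis, and it is w_0 modulo `m`, hence modulo `p`.
    p∣w₀ : + p ∣ w 0
    p∣w₀ = subst (+ p ∣_) (cancel (sum w n) (w 0))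
      (∣m∣n⇒∣m-n (subst (+ p ∣_) (sym (sum-sub ⟦ u ⟧ ⟦ v ⟧ n)) p∣)
        (∣-trans p∣m (subst (λ k → + m ∣ (sum w k ℤ.- w 0)) (sym n≡) (odd-sum q))))
      where
      cancel : ∀ a b → a ℤ.- (a ℤ.- b) ≡ b
      cancel a b = solve (a ∷ b ∷ [])

    m∣w₀ : + m ∣ w 0
    m∣w₀ = odd-part-cancel r (w 0) m≡ p∣w₀ (double-first q closed)

-- The entry sum of the starting vector.

total-e : ∀ m n .{{_ : NonZero m}} .{{_ : NonZero n}} → + m ∣ (total (e m n) ℤ.- 1ℤ)
-- The sum is exactly `1 % m`, which for m = 1 is 0 and only congruent to 1.
total-e m (suc k) = subst (λ z → + m ∣ (z ℤ.- 1ℤ)) (sym total≡) (m∣a%m-a m 1)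
  where
  index : ∀ {i} → i < suc k → toℕ (i mod suc k) ≡ i
  index {i} i<n = trans (toℕ-mod i (suc k)) (m<n⇒m%n≡m i<n)

  0%m : 0 % m ≡ 0
  0%m = ℕ.n≤0⇒n≡0 (m%n≤m 0 m)

  init : ∀ i → i ≤ k → sum ⟦ e m (suc k) ⟧ i ≡ 0ℤ
  init zero    _   = refl
  init (suc i) i<k = cong₂ ℤ._+_ (init i (ℕ.<⇒≤ i<k))
    (cong +_ (trans
      (cong toℕ (lookup-∷ʳ-init k (0 mod m) (1 mod m) (i mod suc k)
        (subst (_< k) (sym (index (ℕ.m<n⇒m<1+n i<k))) i<k)))
      (trans (toℕ-mod 0 m) 0%m)))

  last : ⟦ e m (suc k) ⟧ k ≡ + (1 % m)
  last = cong +_ (trans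
    (cong toℕ (lookup-∷ʳ-last k (0 mod m) (1 mod m) (k mod suc k) (index (ℕ.n<1+n k))))
    (toℕ-mod 1 m))

  total≡ : total (e m (suc k)) ≡ + (1 % m)
  total≡ = trans (cong₂ ℤ._+_ (init k ℕ.≤-refl) last) (ℤ.+-identityˡ _)

-- Divisibility between powers of two.

2^∣2^⇒≤ : ∀ {a b} → 2 ^ a ℕ∣.∣ 2 ^ b → a ≤ b
2^∣2^⇒≤ {a} {b} 2^a∣2^b = ℕ.≮⇒≥ λ b<a →
  >⇒∤ {{ℕ.m^n≢0 2 b}} (ℕ.^-monoʳ-< 2 (s≤s (s≤s z≤n)) b<a) 2^a∣2^b

^-∣ : ∀ {a b} → a ≤ b → 2 ^ a ℕ∣.∣ 2 ^ b
^-∣ {a} {b} a≤b = ℕ∣.divides (2 ^ (b ∸ a))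
  (trans (cong (2 ^_) (sym (ℕ.m∸n+n≡m a≤b))) (ℕ.^-distribˡ-+-* 2 (b ∸ a) a))

-- The orbit of (0,...,0,1): periodic from step l, and not before.

module _ {m n l q r : ℕ} .{{_ : NonZero m}} .{{_ : NonZero n}}
         (n≡ : n ≡ suc (q * 2)) (m≡ : m ≡ 2 ^ l * suc (r * 2)) where

  orbit : ℕ → Vec (ℤ/ m) n
  orbit = iterate D (e m n)

  2^l∣m : + (2 ^ l) ∣ + m
  2^l∣m = ∣ᵤ⇒∣ (ℕ∣.divides (suc (r * 2)) (trans m≡ (ℕ.*-comm (2 ^ l) _)))

  total-orbit : ∀ k → + (2 ^ l) ∣ (total (orbit k) ℤ.- + (2 ^ k))
  total-orbit k = ∣-trans 2^l∣m (total-iterate (e m n) (total-e m n) k)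

  -- From step l on, 2^k vanishes modulo 2^l, so any two such terms meet the sum condition of
  -- `D-cancel`.
  total-orbit-≥ : ∀ k → l ≤ k → + (2 ^ l) ∣ total (orbit k)
  total-orbit-≥ k l≤k = subst (+ (2 ^ l) ∣_) (cancel (total (orbit k)) (+ (2 ^ k)))
    (∣m∣n⇒∣m+n (total-orbit k) (∣ᵤ⇒∣ (^-∣ l≤k)))
    where
    cancel : ∀ a b → a ℤ.- b ℤ.+ b ≡ a
    cancel a b = solve (a ∷ b ∷ [])

  orbit-cancel : ∀ {i j} → l ≤ i → l ≤ j → orbit (suc i) ≡ orbit (suc j) → orbit i ≡ orbit j
  orbit-cancel {i} {j} l≤i l≤j eq = D-cancel {q = q} {r} n≡ m≡ (orbit i) (orbit j)
    (∣m∣n⇒∣m-n (total-orbit-≥ i l≤i) (total-orbit-≥ j l≤j))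
    (trans (sym (iterate-suc D (e m n) i)) (trans eq (iterate-suc D (e m n) j)))

  -- The bounds on `a` and `b` pass to all later indices, so each of the `i` cancellations takes
  -- place beyond step l.
  orbit-cancel-+ : ∀ i {a b} → l ≤ a → l ≤ b → orbit (i + a) ≡ orbit (i + b) → orbit a ≡ orbit b
  orbit-cancel-+ zero    l≤a l≤b eq = eq
  orbit-cancel-+ (suc i) l≤a l≤b eq = orbit-cancel-+ i l≤a l≤b
    (orbit-cancel (ℕ.m≤n⇒m≤o+n i l≤a) (ℕ.m≤n⇒m≤o+n i l≤b) eq)

  periodic-from-l : ∃[ β ] 1 ≤ β × orbit (l + β) ≡ orbit l
  -- Searching for the repetition only from step l on ensures that it can be cancelled `i` times,
  -- leaving the period j - i at l itself.
  periodic-from-l with i , j , i<j , eq ← orbit-repeats (λ i → orbit (i + l)) =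
    j ∸ i , ℕ.m<n⇒0<n∸m i<j ,
    orbit-cancel-+ i (ℕ.m≤m+n l _) ℕ.≤-refl (trans (cong orbit shift) (sym eq))
    where
    open ≡-Reasoning

    shift : i + (l + (j ∸ i)) ≡ j + l
    shift = begin
      i + (l + (j ∸ i)) ≡⟨ cong (λ a → i + a) (ℕ.+-comm l (j ∸ i)) ⟩
      i + (j ∸ i + l)   ≡⟨ ℕ.+-assoc i (j ∸ i) l ⟨
      i + (j ∸ i) + l   ≡⟨ cong (_+ l) (ℕ.m+[n∸m]≡n (ℕ.<⇒≤ i<j)) ⟩
      j + l             ∎

  l≤periodic : ∀ α → ∃[ β ] 1 ≤ β × orbit (α + β) ≡ orbit α → l ≤ α
  -- If α < l, then 2^(α+1) divides 2^l, so the congruence modulo 2^l may be read modulo 2^(α+1).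
  l≤periodic α (β , 1≤β , eq) = ℕ.≮⇒≥ λ α<l → ℕ.1+n≰n
    (2^∣2^⇒≤ {suc α} {α} (∣⇒∣ᵤ (∣-2^α (∣-trans (∣ᵤ⇒∣ (^-∣ α<l)) 2^l∣difference))))
    where
    regroup : ∀ t a b → t ℤ.- a ℤ.- (t ℤ.- b) ≡ b ℤ.- a
    regroup t a b = solve (t ∷ a ∷ b ∷ [])

    cancel : ∀ a b → a ℤ.- (a ℤ.- b) ≡ b
    cancel a b = solve (a ∷ b ∷ [])

    2^l∣difference : + (2 ^ l) ∣ (+ (2 ^ (α + β)) ℤ.- + (2 ^ α))
    2^l∣difference = subst (+ (2 ^ l) ∣_)
      (regroup (total (orbit α)) (+ (2 ^ α)) (+ (2 ^ (α + β))))
      (∣m∣n⇒∣m-n (total-orbit α)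
        (subst (λ u → + (2 ^ l) ∣ (total u ℤ.- + (2 ^ (α + β)))) eq (total-orbit (α + β))))

    ∣-2^α : + (2 ^ suc α) ∣ (+ (2 ^ (α + β)) ℤ.- + (2 ^ α)) → + (2 ^ suc α) ∣ + (2 ^ α)
    ∣-2^α d = subst (+ (2 ^ suc α) ∣_) (cancel (+ (2 ^ (α + β))) (+ (2 ^ α)))
      -- Since β ≥ 1, the term 2^(α+β) is itself a multiple of 2^(α+1) and can be removed.
      (∣m∣n⇒∣m-n {m = + (2 ^ (α + β))}
        (∣ᵤ⇒∣ (^-∣ (subst (_≤ α + β) (ℕ.+-comm α 1) (ℕ.+-monoʳ-≤ α 1≤β)))) d)

theorem2 : ∀ (n m l m₁ : ℕ) .{{_ : NonZero n}} .{{_ : NonZero m}} .{{_ : NonZero m₁}} →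
    Odd n → Odd m₁ → m ≡ 2 ^ l * m₁ → IsL m n l
theorem2 n m l m₁ odd-n odd-m₁ m≡ =
  let q , n≡  = odd⇒suc-double n odd-n
      r , m₁≡ = odd⇒suc-double m₁ odd-m₁
      m≡′     = trans m≡ (cong (2 ^ l *_) m₁≡)
  in periodic-from-l {l = l} {q} {r} n≡ m≡′ , l≤periodic {l = l} {q} {r} n≡ m≡′
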